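{- Let $G$ be a nonempty graph (that is, a finite simple graph with at least one edge). The following are equivalent. (i) $c_2(G) \neq \mathrm{mr}(G,\mathbb{F}_2)$; (ii) $c_2(G) = \mathrm{mr}(G,\mathbb{F}_2) + 1$; (iii) there is a unique matrix $A$ of minimum rank over $\mathbb{F}_2$ which fits $G$, and every diagonal entry of $A$ is $0$; (iv) there is a minimum subgraph complementation system for $G$ in which every vertex appears an even number of times; (v) for every component $G'$ of $G$, $c_2(G') = \mathrm{mr}(G', \mathbb{F}_2) + 1$.
   Context: All graphs are finite and simple. A component of a graph is a connected component. A subgraph complementation system for a graph $G=(V,E)$ is a finite collection (family) $\mathscr{C}$ of subsets of $V$ such that, for any two distinct vertices $u,v\in V$, $uv\in E$ if and only if $u$ and $v$ appear together in an odd number of sets in $\mathscr{C}$. The subgraph complementation number $c_2(G)$ is the minimum cardinality of a subgraph complementation system for $G$; a subgraph complementation system is minimum if its cardinality is $c_2(G)$. The number of times a vertex $v$ appears in $\mathscr{C}$ is the number of sets of $\mathscr{C}$ containing $v$. A symmetric matrix over a field $\mathbb{F}$ with rows and columns indexed by $V$ fits $G$ if, for distinct $u,v$, its $(u,v)$ entry is nonzero if and only if $uv\in E$ (the diagonal is arbitrary). $\mathrm{mr}(G,\mathbb{F})$ is the minimum rank over $\mathbb{F}$ of a symmetric matrix over $\mathbb{F}$ which fits $G$; a matrix of minimum rank over $\mathbb{F}_2$ which fits $G$ is one of rank $\mathrm{mr}(G,\mathbb{F}_2)$. Here $\mathbb{F}_2$ is the field of order $2$.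
   Formalization: Condition (v) is asked only of components with at least one edge: an isolated vertex has c_2 = mr = 0, so as written (v) fails for K_{2,2,1} plus an isolated vertex, although (i)–(iv) hold there (c_2 = 3, mr = 2). -}

module Defs where

open import Algebra.Bundles using (CommutativeRing)
open import Data.Fin.Base using (Fin; zero; suc)
open import Data.Fin.Properties using (any?; all?; injective⇒≤) renaming (_≟_ to _≟ᶠ_)
open import Data.Fin.Subset using (Subset; _∈_; ⁅_⁆; _∪_)
open import Data.Fin.Subset.Properties
  using (_∈?_; anySubset?; x∈⁅x⁆; x∈⁅y⁆⇒x≡y; x∈p∪q⁺; x∈p∪q⁻)
open import Data.List.Base
  using (List; []; _∷_; length; filter; allFin; cartesianProduct)
open import Data.List.Membership.Propositional.Properties
  using (∈-allFin; ∈-cartesianProduct⁺)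
open import Data.List.Properties using (filter-accept; filter-reject)
open import Data.List.Relation.Unary.All as All using (All; []; _∷_)
open import Data.Nat.Base as ℕ using (ℕ; zero; suc; _≤_; z≤n; s≤s; parity)
import Data.Nat.Properties as ℕ
open import Data.Parity.Base as ℙ using (Parity; 0ℙ; 1ℙ)
import Data.Parity.Properties as ℙ
open import Data.Product using (∃; ∃₂; _×_; _,_; proj₁; proj₂)
open import Data.Sum.Base using (_⊎_; inj₁; inj₂; [_,_]′)
open import Data.Vec.Functional as Vector using (Vector; head; tail)
open import Data.Vec.Functional.Relation.Binary.Pointwise using (Pointwise)
open import Function.Base using (_∘_; id)
open import Function.Bundles using (_⇔_; mk⇔; Equivalence)
open import Function.Definitions using (Injective)
open import Level using (0ℓ)
open import Relation.Binary.Construct.Closure.ReflexiveTransitive using (Star)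
open import Relation.Binary.Core using (Rel)
open import Relation.Binary.Definitions
  using (Decidable; Symmetric; Irreflexive; Reflexive; _Respects_)
open import Relation.Binary.PropositionalEquality
open import Relation.Nullary.Decidable as Dec
  using (Dec; yes; no; _×-dec_; _⊎-dec_; _→-dec_; ¬?)
open import Relation.Nullary.Negation using (¬_; contradiction)
import Relation.Unary as U

IsMinimum : (ℕ → Set) → ℕ → Set
IsMinimum P m = P m × (∀ k → P k → m ≤ k)

IsMaximum : (ℕ → Set) → ℕ → Set
IsMaximum P m = P m × (∀ k → P k → k ≤ m)

minimum : {P : ℕ → Set} → U.Decidable P → ∃ P → ∃ (IsMinimum P)
minimum {P} P? (n , pn) = go P? n pn
  where
  go : {Q : ℕ → Set} → U.Decidable Q → ∀ n → Q n → ∃ (IsMinimum Q)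
  go Q? zero qn = zero , qn , λ _ _ → z≤n
  go Q? (suc n) qn with Q? zero
  ... | yes q0 = zero , q0 , λ _ _ → z≤n
  ... | no ¬q0 with go (Q? ∘ suc) n qn
  ...   | m , qm , least = suc m , qm , λ where
            zero    q0 → contradiction q0 ¬q0
            (suc k) qk → s≤s (least k qk)

maximum : {P : ℕ → Set} → U.Decidable P → P 0 →
          ∀ b → (∀ k → P k → k ≤ b) → ∃ (IsMaximum P)
maximum P? p0 zero    bound = zero , p0 , bound
maximum P? p0 (suc b) bound with P? (suc b)
... | yes p = suc b , p , bound
... | no ¬p = maximum P? p0 b λ k pk →
  ℕ.s≤s⁻¹ (ℕ.≤∧≢⇒< (bound k pk) λ { refl → ¬p pk })

Searchable : {A : Set} → Rel A 0ℓ → Set₁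
Searchable _≈_ = ∀ {P} → P Respects _≈_ → U.Decidable P → Dec (∃ P)

searchVector : ∀ {A : Set} {_≈_ : Rel A 0ℓ} → Reflexive _≈_ →
               Searchable _≈_ → ∀ k → Searchable (Pointwise _≈_ {k})
searchVector rfl S? zero resp P? =
  Dec.map′ (Vector.[] ,_) (λ (f , p) → resp {f} {Vector.[]} (λ ()) p) (P? Vector.[])
searchVector {A} {_≈_} rfl S? (suc k) {P} resp P? =
  Dec.map′ (λ (x , f , p) → x Vector.∷ f , p)
           (λ (f , p) → head f , tail f , resp (η f) p)
           (S? respHead λ x → searchVector rfl S? k (respTail x) (λ f → P? (x Vector.∷ f)))
  where
  η : ∀ f → Pointwise _≈_ f (head f Vector.∷ tail f)
  η f zero    = rfl
  η f (suc i) = rfl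
  respHead : (λ x → ∃ λ f → P (x Vector.∷ f)) Respects _≈_
  respHead x≈y (f , p) = f , resp (λ { zero → x≈y ; (suc i) → rfl }) p
  respTail : ∀ x → (λ f → P (x Vector.∷ f)) Respects Pointwise _≈_
  respTail x f≈g = resp λ { zero → rfl ; (suc i) → f≈g i }

searchParity : Searchable {Parity} _≡_
searchParity {P} resp P? =
  Dec.map′ [ 0ℙ ,_ , 1ℙ ,_ ]′ (λ { (0ℙ , p) → inj₁ p ; (1ℙ , p) → inj₂ p })
           (P? 0ℙ ⊎-dec P? 1ℙ)

searchFin : ∀ n → Searchable {Fin n} _≡_
searchFin n resp P? = any? P?

searchAll : {A : Set} {_≈_ : Rel A 0ℓ} {P : A → Set} → Symmetric _≈_ →
            Searchable _≈_ → P Respects _≈_ → U.Decidable P → Dec (∀ x → P x)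
searchAll ≈-sym S? resp P? =
  Dec.map′ (λ ∄ x → Dec.decidable-stable (P? x) λ ¬p → ∄ (x , ¬p))
           (λ ∀p (x , ¬p) → ¬p (∀p x))
           (¬? (S? (λ x≈y ¬px py → ¬px (resp (≈-sym x≈y) py)) (λ x → ¬? (P? x))))

searchFamily : ∀ {n} k {P : List (Subset n) → Set} → U.Decidable P →
               Dec (∃ λ 𝒞 → length 𝒞 ≡ k × P 𝒞)
searchFamily zero P? =
  Dec.map′ (λ p → [] , refl , p) (λ { ([] , _ , p) → p }) (P? [])
searchFamily (suc k) P? =
  Dec.map′ (λ (S , 𝒞 , eq , p) → S ∷ 𝒞 , cong suc eq , p)
           (λ { (S ∷ 𝒞 , eq , p) → S , 𝒞 , ℕ.suc-injective eq , p })
           (anySubset? λ S → searchFamily k (λ 𝒞 → P? (S ∷ 𝒞)))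

infix 4 _⇔-dec_
_⇔-dec_ : {A B : Set} → Dec A → Dec B → Dec (A ⇔ B)
a? ⇔-dec b? = Dec.map′ (λ (f , g) → mk⇔ f g)
  (λ e → Equivalence.to e , Equivalence.from e)
  ((a? →-dec b?) ×-dec (b? →-dec a?))

record Graph (n : ℕ) : Set₁ where
  infix 4 _~_ _~?_
  field
    _~_      : Rel (Fin n) 0ℓ
    _~?_     : Decidable _~_
    ~-sym    : Symmetric _~_
    ~-irrefl : Irreflexive _≡_ _~_

-- Isolated vertices matter for statements about components: the one-vertex
-- graph has c₂ = mr = 0, so an equation c₂ = mr + 1 can only be asked of
-- components that are themselves nonempty in this sense.
NonemptyGraph : ∀ {n} → Graph n → Set
NonemptyGraph G = ∃₂ λ u v → u ~ v
  where open Graph G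

-- A connected component, presented as a graph of its own (its vertices
-- relabelled by Fin order, in any way) embedded as an induced subgraph whose
-- vertex set is the set of all vertices reachable from some vertex `root`.
record Component {n} (G : Graph n) : Set₁ where
  field
    {order}         : ℕ
    graph           : Graph order
    embed           : Fin order → Fin n
    embed-injective : Injective _≡_ _≡_ embed
    embed-induced   : ∀ u v → Graph._~_ graph u v ⇔ Graph._~_ G (embed u) (embed v)
    root            : Fin n
    image           : ∀ v → (∃ λ w → embed w ≡ v) ⇔ Star (Graph._~_ G) root v

-- A family is a list, so its cardinality counts repetitions.
appearances : ∀ {n} → Fin n → List (Subset n) → ℕ
appearances v 𝒞 = length (filter (v ∈?_) 𝒞)

both? : ∀ {n} (u v : Fin n) → U.Decidable (λ (S : Subset n) → u ∈ S × v ∈ S)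
both? u v S = u ∈? S ×-dec v ∈? S

jointAppearances : ∀ {n} → Fin n → Fin n → List (Subset n) → ℕ
jointAppearances u v 𝒞 = length (filter (both? u v) 𝒞)

IsSystem : ∀ {n} → Graph n → List (Subset n) → Set
IsSystem G 𝒞 = ∀ u v → u ≢ v → u ~ v ⇔ parity (jointAppearances u v 𝒞) ≡ 1ℙ
  where open Graph G

isSystem? : ∀ {n} (G : Graph n) → U.Decidable (IsSystem G)
isSystem? G 𝒞 = all? λ u → all? λ v → ¬? (u ≟ᶠ v) →-dec
  ((u ~? v) ⇔-dec (parity (jointAppearances u v 𝒞) ℙ.≟ 1ℙ))
  where open Graph G

-- Every graph has a system: run through all pairs of vertices, adding {i , j}
-- whenever the status of the pair (i , j) is wrong.
module _ {n} (G : Graph n) where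
  open Graph G

  private
    Correct : List (Subset n) → Fin n × Fin n → Set
    Correct 𝒞 (u , v) = u ≢ v → u ~ v ⇔ parity (jointAppearances u v 𝒞) ≡ 1ℙ

    correct? : ∀ 𝒞 → U.Decidable (Correct 𝒞)
    correct? 𝒞 (u , v) = ¬? (u ≟ᶠ v) →-dec
      ((u ~? v) ⇔-dec (parity (jointAppearances u v 𝒞) ℙ.≟ 1ℙ))

    joint-comm : ∀ (u v : Fin n) 𝒞 → jointAppearances u v 𝒞 ≡ jointAppearances v u 𝒞
    joint-comm u v [] = refl
    joint-comm u v (S ∷ 𝒞) with u ∈? S | v ∈? S
    ... | yes _ | yes _ = cong suc (joint-comm u v 𝒞)
    ... | yes _ | no  _ = joint-comm u v 𝒞
    ... | no  _ | yes _ = joint-comm u v 𝒞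
    ... | no  _ | no  _ = joint-comm u v 𝒞

    correct-sym : ∀ {𝒞 u v} → Correct 𝒞 (u , v) → Correct 𝒞 (v , u)
    correct-sym {𝒞} {u} {v} c v≢u = mk⇔
      (λ v~u → trans (cong parity (joint-comm v u 𝒞))
                 (Equivalence.to (c (v≢u ∘ sym)) (~-sym v~u)))
      (λ p → ~-sym (Equivalence.from (c (v≢u ∘ sym))
               (trans (cong parity (joint-comm u v 𝒞)) p)))

    pair : Fin n → Fin n → Subset n
    pair i j = ⁅ i ⁆ ∪ ⁅ j ⁆

    ∈pair : ∀ {i j u} → u ∈ pair i j → u ≡ i ⊎ u ≡ j
    ∈pair {i} {j} u∈ with x∈p∪q⁻ ⁅ i ⁆ ⁅ j ⁆ u∈
    ... | inj₁ p = inj₁ (x∈⁅y⁆⇒x≡y i p)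
    ... | inj₂ p = inj₂ (x∈⁅y⁆⇒x≡y j p)

    -- If p ≡ 1 does not express A, then the opposite parity does.
    flip : ∀ {A : Set} (a? : Dec A) k → ¬ (A ⇔ parity k ≡ 1ℙ) →
           A ⇔ parity (suc k) ≡ 1ℙ
    flip a? k wrong with parity k | parity (suc k) | ℙ.suc-homo-⁻¹ k | a?
    ... | 0ℙ | 1ℙ | refl | yes a = mk⇔ (λ _ → refl) (λ _ → a)
    ... | 0ℙ | 1ℙ | refl | no ¬a = contradiction (mk⇔ (λ a → contradiction a ¬a) λ ()) wrong
    ... | 1ℙ | 0ℙ | refl | yes a = contradiction (mk⇔ (λ _ → refl) (λ _ → a)) wrong
    ... | 1ℙ | 0ℙ | refl | no ¬a = mk⇔ (λ a → contradiction a ¬a) λ ()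

    fixed : ∀ {𝒞 i j} → ¬ Correct 𝒞 (i , j) → Correct (pair i j ∷ 𝒞) (i , j)
    fixed {𝒞} {i} {j} wrong i≢j = subst (λ k → (i ~ j) ⇔ parity k ≡ 1ℙ)
      (sym (cong length (filter-accept (both? i j) {x = pair i j} {xs = 𝒞}
        (x∈p∪q⁺ (inj₁ (x∈⁅x⁆ i)) , x∈p∪q⁺ (inj₂ (x∈⁅x⁆ j))))))
      (flip (i ~? j) (jointAppearances i j 𝒞) (λ c → wrong (λ _ → c)))

    kept : ∀ {𝒞 i j} → ¬ Correct 𝒞 (i , j) → ∀ {p} → Correct 𝒞 p →
           Correct (pair i j ∷ 𝒞) p
    kept {𝒞} {i} {j} wrong {u , v} c u≢v with both? u v (pair i j)
    ... | no ∉ = subst (λ k → (u ~ v) ⇔ parity k ≡ 1ℙ)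
      (sym (cong length (filter-reject (both? u v) {x = pair i j} {xs = 𝒞} ∉))) (c u≢v)
    ... | yes (u∈ , v∈) with ∈pair u∈ | ∈pair v∈
    ...   | inj₁ refl | inj₁ refl = contradiction refl u≢v
    ...   | inj₂ refl | inj₂ refl = contradiction refl u≢v
    ...   | inj₁ refl | inj₂ refl = contradiction c wrong
    ...   | inj₂ refl | inj₁ refl = contradiction (correct-sym {𝒞} c) wrong

    correctAll : ∀ ps → ∃ λ 𝒞 → All (Correct 𝒞) ps
    correctAll [] = [] , []
    correctAll ((i , j) ∷ ps) with correctAll ps
    ... | 𝒞 , cs with correct? 𝒞 (i , j)
    ...   | yes c = 𝒞 , c ∷ cs
    ...   | no ¬c = pair i j ∷ 𝒞 , fixed {𝒞} ¬c ∷ All.map (kept {𝒞} ¬c) cs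

  ∃-system : ∃ (IsSystem G)
  ∃-system with correctAll (cartesianProduct (allFin n) (allFin n))
  ... | 𝒞 , cs = 𝒞 , λ u v →
    All.lookup cs (∈-cartesianProduct⁺ (∈-allFin u) (∈-allFin v))

  c₂-minimum : ∃ (IsMinimum λ k → ∃ λ 𝒞 → length 𝒞 ≡ k × IsSystem G 𝒞)
  c₂-minimum = minimum (λ k → searchFamily k (isSystem? G))
    (let 𝒞 , sys = ∃-system in length 𝒞 , 𝒞 , refl , sys)

  c₂ : ℕ
  c₂ = proj₁ c₂-minimum

  IsMinimumSystem : List (Subset n) → Set
  IsMinimumSystem 𝒞 = IsSystem G 𝒞 × length 𝒞 ≡ c₂

-- Parity with its addition and multiplication is the field of order 2.
𝔽₂ : Set
𝔽₂ = Parity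

open import Algebra.Properties.Semiring.Sum
  (CommutativeRing.semiring ℙ.+-*-commutativeRing)
  using (sum; sum-cong-≗; sum-replicate-zero; ∑-distrib-+)

Matrix : ℕ → ℕ → Set
Matrix m n = Vector (Vector 𝔽₂ n) m

infix 4 _≐_
_≐_ : ∀ {m n} → Rel (Matrix m n) 0ℓ
A ≐ B = ∀ i j → A i j ≡ B i j

column : ∀ {m n} → Matrix m n → Fin n → Vector 𝔽₂ m
column A j i = A i j

LinearlyIndependent : ∀ {m k} → Vector (Vector 𝔽₂ m) k → Set
LinearlyIndependent {m} {k} x = ∀ (a : Vector 𝔽₂ k) →
  (∀ i → sum (λ l → a l ℙ.* x l i) ≡ 0ℙ) → ∀ l → a l ≡ 0ℙ

-- Independence of the chosen columns forces the selection s to be injective.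
HasIndependentColumns : ∀ {m n} → Matrix m n → ℕ → Set
HasIndependentColumns {n = n} A k =
  ∃ λ (s : Fin k → Fin n) → LinearlyIndependent (column A ∘ s)

linearlyIndependent-resp : ∀ {m k} →
  LinearlyIndependent {m} {k} Respects (λ x y → ∀ l i → x l i ≡ y l i)
linearlyIndependent-resp x≈y ind a a·y≡0 = ind a λ i →
  trans (sum-cong-≗ λ l → cong (a l ℙ.*_) (x≈y l i)) (a·y≡0 i)

linearlyIndependent? : ∀ {m k} → U.Decidable (LinearlyIndependent {m} {k})
linearlyIndependent? {m} {k} x =
  searchAll (λ a≗b → sym ∘ a≗b) (searchVector refl searchParity k)
    (λ a≗b h b·x≡0 l → trans (sym (a≗b l))
      (h (λ i → trans (sum-cong-≗ λ l → cong (ℙ._* x l i) (a≗b l)) (b·x≡0 i)) l))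
    (λ a → all? (λ i → sum (λ l → a l ℙ.* x l i) ℙ.≟ 0ℙ) →-dec all? (λ l → a l ℙ.≟ 0ℙ))

hasIndependentColumns? : ∀ {m n} (A : Matrix m n) → U.Decidable (HasIndependentColumns A)
hasIndependentColumns? {n = n} A k = searchVector refl (searchFin n) k
  (λ s≗t → linearlyIndependent-resp λ l i → cong (A i) (s≗t l))
  (λ s → linearlyIndependent? (column A ∘ s))

private
  δ : ∀ {k} → Fin k → Vector 𝔽₂ k
  δ zero    zero    = 1ℙ
  δ zero    (suc l) = 0ℙ
  δ (suc p) zero    = 0ℙ
  δ (suc p) (suc l) = δ p l

  δ-diag : ∀ {k} (p : Fin k) → δ p p ≡ 1ℙ
  δ-diag zero    = refl
  δ-diag (suc p) = δ-diag p

  δ-off : ∀ {k} {p q : Fin k} → p ≢ q → δ q p ≡ 0ℙ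
  δ-off {p = zero}  {zero}  p≢q = contradiction refl p≢q
  δ-off {p = zero}  {suc q} p≢q = refl
  δ-off {p = suc p} {zero}  p≢q = refl
  δ-off {p = suc p} {suc q} p≢q = δ-off (p≢q ∘ cong suc)

  sum-δ : ∀ {k} (p : Fin k) (f : Vector 𝔽₂ k) → sum (λ l → δ p l ℙ.* f l) ≡ f p
  sum-δ {suc k} zero    f = trans (cong (f zero ℙ.+_) (sum-replicate-zero k))
                                  (ℙ.+-identityʳ (f zero))
  sum-δ {suc k} (suc p) f = sum-δ p (tail f)

  independent⇒injective : ∀ {m n k} (A : Matrix m n) (s : Fin k → Fin n) →
    LinearlyIndependent (column A ∘ s) → Injective _≡_ _≡_ s
  independent⇒injective A s ind {p} {q} sp≡sq with p ≟ᶠ q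
  ... | yes p≡q = p≡q
  ... | no  p≢q = contradiction
    (trans (sym (cong₂ ℙ._+_ (δ-diag p) (δ-off p≢q)))
           (ind (λ l → δ p l ℙ.+ δ q l) dep p)) λ ()
    where
    dep : ∀ i → sum (λ l → (δ p l ℙ.+ δ q l) ℙ.* A i (s l)) ≡ 0ℙ
    dep i = begin
      sum (λ l → (δ p l ℙ.+ δ q l) ℙ.* x l)
        ≡⟨ sum-cong-≗ (λ l → ℙ.*-distribʳ-+ (x l) (δ p l) (δ q l)) ⟩
      sum (λ l → (δ p l ℙ.* x l) ℙ.+ (δ q l ℙ.* x l))
        ≡⟨ ∑-distrib-+ (λ l → δ p l ℙ.* x l) (λ l → δ q l ℙ.* x l) ⟩
      sum (λ l → δ p l ℙ.* x l) ℙ.+ sum (λ l → δ q l ℙ.* x l)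
        ≡⟨ cong₂ ℙ._+_ (sum-δ p x) (sum-δ q x) ⟩
      x p ℙ.+ x q
        ≡⟨ cong (λ j → A i j ℙ.+ x q) sp≡sq ⟩
      x q ℙ.+ x q
        ≡⟨ ℙ.p+p≡0ℙ (x q) ⟩
      0ℙ ∎
      where
      open ≡-Reasoning
      x = λ l → A i (s l)

rank-maximum : ∀ {m n} (A : Matrix m n) → ∃ (IsMaximum (HasIndependentColumns A))
rank-maximum {n = n} A = maximum (hasIndependentColumns? A)
  ((λ ()) , λ _ _ ()) n
  (λ k (s , ind) → injective⇒≤ (independent⇒injective A s ind))

rank : ∀ {m n} → Matrix m n → ℕ
rank A = proj₁ (rank-maximum A)

rank-cong : ∀ {m n} {A B : Matrix m n} → A ≐ B → rank A ≡ rank B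
rank-cong A≐B = ℕ.≤-antisym (mono A≐B) (mono λ i j → sym (A≐B i j))
  where
  mono : ∀ {m n} {A B : Matrix m n} → A ≐ B → rank A ≤ rank B
  mono {A = A} {B} A≐B with rank-maximum A | rank-maximum B
  ... | r , (s , ind) , _ | _ , _ , max =
    max r (s , linearlyIndependent-resp (λ l i → A≐B i (s l)) ind)

IsSymmetric : ∀ {n} → Matrix n n → Set
IsSymmetric A = ∀ u v → A u v ≡ A v u

module _ {n} (G : Graph n) where
  open Graph G

  Fits : Matrix n n → Set
  Fits A = IsSymmetric A × (∀ u v → u ≢ v → A u v ≢ 0ℙ ⇔ u ~ v)

  fits? : U.Decidable Fits
  fits? A = (all? λ u → all? λ v → A u v ℙ.≟ A v u) ×-dec
    (all? λ u → all? λ v → ¬? (u ≟ᶠ v) →-dec (¬? (A u v ℙ.≟ 0ℙ) ⇔-dec (u ~? v)))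

  fits-resp : Fits Respects _≐_
  fits-resp A≐B (symm , fit) =
    (λ u v → trans (sym (A≐B u v)) (trans (symm u v) (A≐B v u))) ,
    (λ u v u≢v → subst (λ x → x ≢ 0ℙ ⇔ u ~ v) (A≐B u v) (fit u v u≢v))

  ∃-fits : ∃ Fits
  ∃-fits = (λ u v → entry (u ~? v)) ,
           (λ u v → entry-sym (u ~? v) (v ~? u)) ,
           (λ u v _ → entry-fits (u ~? v))
    where
    entry : {A : Set} → Dec A → 𝔽₂
    entry (yes _) = 1ℙ
    entry (no _)  = 0ℙ
    entry-sym : ∀ {u v} (d : Dec (u ~ v)) (e : Dec (v ~ u)) → entry d ≡ entry e
    entry-sym (yes _) (yes _) = refl
    entry-sym (yes p) (no ¬q) = contradiction (~-sym p) ¬q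
    entry-sym (no ¬p) (yes q) = contradiction (~-sym q) ¬p
    entry-sym (no _)  (no _)  = refl
    entry-fits : {A : Set} (d : Dec A) → entry d ≢ 0ℙ ⇔ A
    entry-fits (yes a) = mk⇔ (λ _ → a) (λ _ ())
    entry-fits (no ¬a) = mk⇔ (contradiction refl) (λ a _ → ¬a a)

  mr-minimum : ∃ (IsMinimum λ r → ∃ λ A → rank A ≡ r × Fits A)
  mr-minimum = minimum
    (λ r → searchVector (λ _ → refl) (searchVector refl searchParity n) n
      (λ A≐B (eq , fit) → trans (sym (rank-cong A≐B)) eq , fits-resp A≐B fit)
      (λ A → (rank A ℕ.≟ r) ×-dec fits? A))
    (let A , fit = ∃-fits in rank A , A , refl , fit)

  mr : ℕ
  mr = proj₁ mr-minimum

  IsMinimumRankFit : Matrix n n → Set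
  IsMinimumRankFit A = Fits A × rank A ≡ mr

{-# OPTIONS --safe #-}

-- A family of k sets with incidence matrix M is a system for G exactly when the
-- Gram matrix M Mᵀ fits G, so c₂ is the least k for which some fitting A is M Mᵀ
-- with k columns.  A symmetric A of rank r is such a product with r columns if
-- its diagonal is not zero, and otherwise only with r + 1: a zero diagonal makes
-- the columns of M sum to zero, so that rank A < k.  Hence c₂ ≢ mr if and only if
-- every fit of minimum rank is alternating, and since all fits agree off the
-- diagonal there is then only one.  The rank is additive over a component and the
-- rest of the graph, so this property is inherited by components and can be
-- tested on them.

module Submission where

open import Defs
open import Algebra.Bundles using (CommutativeRing)
open import Data.Bool.Base using (if_then_else_)
open import Data.Fin.Base
  using (Fin; zero; suc; splitAt; _↑ˡ_; _↑ʳ_; combine; finToFun; funToFin)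
open import Data.Fin.Properties
  using (any?; all?; injective⇒≤; finToFun-funToFin; funToFin-finToFin; sequence;
         splitAt⁻¹-↑ˡ; splitAt⁻¹-↑ʳ; suc-injective)
  renaming (_≟_ to _≟ᶠ_)
open import Data.Fin.Subset using (Subset)
open import Data.Fin.Subset.Properties using (_∈?_)
open import Data.List.Base using (List; []; _∷_; length; lookup)
open import Data.List.Properties using (filter-≐)
open import Data.Nat.Base as ℕ using (ℕ; zero; suc; _≤_; _<_; z≤n; s≤s; parity)
import Data.Nat.Properties as ℕ
open import Data.Parity.Base as ℙ using (Parity; 0ℙ; 1ℙ)
import Data.Parity.Properties as ℙ
open import Data.Product using (∃; ∃₂; _×_; _,_; proj₁; proj₂)
open import Data.Sum.Base using (_⊎_; inj₁; inj₂; [_,_]′)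
import Data.Vec.Base as Vec
import Data.Vec.Properties as Vec
open import Data.Vec.Functional as Vector using (Vector)
open import Data.Vec.Functional.Properties using (lookup-++ˡ; lookup-++ʳ)
open import Effect.Monad using (RawMonad)
open import Function.Base using (_∘_; id; const)
open import Function.Bundles using (_⇔_; mk⇔; Equivalence)
open import Function.Definitions using (Injective)
open import Relation.Binary.Construct.Closure.ReflexiveTransitive using (Star; ε; _◅_; _◅◅_)
open import Relation.Binary.PropositionalEquality
open import Relation.Nullary.Decidable as Dec
  using (Dec; yes; no; does; from-yes; ¬¬-excluded-middle)
open import Relation.Nullary.Negation using (¬_; contradiction; ¬¬-Monad)
import Relation.Unary as U
open import Algebra.Properties.Semiring.Sum
  (CommutativeRing.semiring ℙ.+-*-commutativeRing)
  using (sum; sum-cong-≗; sum-replicate-zero; ∑-distrib-+; ∑-comm;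
         *-distribˡ-sum; *-distribʳ-sum)

-- Rank over 𝔽₂

-- With only two values to try, nested uses under `from-yes` prove polynomial identities over 𝔽₂ by
-- truth table.
∀ℙ? : {P : Parity → Set} → U.Decidable P → Dec (∀ p → P p)
∀ℙ? = searchAll sym searchParity λ { refl p → p }

+≡0⇒≡ : ∀ {p q} → p ℙ.+ q ≡ 0ℙ → p ≡ q
+≡0⇒≡ {0ℙ} {0ℙ} _ = refl
+≡0⇒≡ {1ℙ} {1ℙ} _ = refl

≢0⇒≡1 : ∀ {p} → p ≢ 0ℙ → p ≡ 1ℙ
≢0⇒≡1 {0ℙ} p≢0 = contradiction refl p≢0
≢0⇒≡1 {1ℙ} _   = refl

≢1⇒≡0 : ∀ {p} → p ≢ 1ℙ → p ≡ 0ℙ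
≢1⇒≡0 {0ℙ} _   = refl
≢1⇒≡0 {1ℙ} p≢1 = contradiction refl p≢1

sum-zero : ∀ {k} {f : Vector 𝔽₂ k} → (∀ l → f l ≡ 0ℙ) → sum f ≡ 0ℙ
sum-zero {k} f≡0 = trans (sum-cong-≗ f≡0) (sum-replicate-zero k)

sum-++ : ∀ m {n} (f : Vector 𝔽₂ (m ℕ.+ n)) →
         sum f ≡ sum (λ l → f (l ↑ˡ n)) ℙ.+ sum (λ l → f (m ↑ʳ l))
sum-++ zero    f = refl
sum-++ (suc m) f = trans (cong (f zero ℙ.+_) (sum-++ m (f ∘ suc)))
                         (sym (ℙ.+-assoc (f zero) _ _))

funToFin-cong : ∀ {m n} {f g : Fin m → Fin n} → f ≗ g → funToFin f ≡ funToFin g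
funToFin-cong {zero}  f≗g = refl
funToFin-cong {suc m} f≗g = cong₂ combine (f≗g zero) (funToFin-cong (f≗g ∘ suc))

bit : 𝔽₂ → Fin 2
bit 0ℙ = zero
bit 1ℙ = suc zero

unbit : Fin 2 → 𝔽₂
unbit zero       = 0ℙ
unbit (suc zero) = 1ℙ

bit-injective : ∀ {p q} → bit p ≡ bit q → p ≡ q
bit-injective {0ℙ} {0ℙ} _ = refl
bit-injective {1ℙ} {1ℙ} _ = refl

unbit-injective : ∀ {i j} → unbit i ≡ unbit j → i ≡ j
unbit-injective {zero}     {zero}     _ = refl
unbit-injective {zero}     {suc zero} ()
unbit-injective {suc zero} {zero}     ()
unbit-injective {suc zero} {suc zero} _ = refl

-- Counting takes the place of an exchange argument: 2^r vectors embed among 2^k, so r ≤ k.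
injection⇒≤ : ∀ {r k} (φ : Vector 𝔽₂ r → Vector 𝔽₂ k) →
              (∀ a b → φ a ≗ φ b → a ≗ b) → r ≤ k
injection⇒≤ {r} {k} φ φ-injective =
  ℕ.≮⇒≥ λ k<r → ℕ.<⇒≱ (ℕ.^-monoʳ-< 2 (s≤s (s≤s z≤n)) k<r) (injective⇒≤ {f = code} code-injective)
  where
  decode : Fin (2 ℕ.^ r) → Vector 𝔽₂ r
  decode i = unbit ∘ finToFun i

  code : Fin (2 ℕ.^ r) → Fin (2 ℕ.^ k)
  code i = funToFin (bit ∘ φ (decode i))

  code-injective : Injective _≡_ _≡_ code
  code-injective {i} {j} eq = begin
    i ≡⟨ funToFin-finToFin {r} {2} i ⟨
    funToFin (finToFun {2} {r} i) ≡⟨ funToFin-cong (λ l → unbit-injective (decode≗ l)) ⟩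
    funToFin (finToFun {2} {r} j) ≡⟨ funToFin-finToFin {r} {2} j ⟩
    j ∎
    where
    open ≡-Reasoning
    decode≗ : decode i ≗ decode j
    decode≗ = φ-injective _ _ λ l → bit-injective
      (trans (sym (finToFun-funToFin (bit ∘ φ (decode i)) l))
             (trans (cong (λ c → finToFun c l) eq)
                    (finToFun-funToFin (bit ∘ φ (decode j)) l)))

infixl 7 _·_
_·_ : ∀ {m k n} → Matrix m k → Matrix k n → Matrix m n
(X · Y) i j = sum λ l → X i l ℙ.* Y l j

independentColumns : ∀ {m n} (A : Matrix m n) → HasIndependentColumns A (rank A)
independentColumns A = proj₁ (proj₂ (rank-maximum A))

independentColumns⇒≤rank : ∀ {m n k} (A : Matrix m n) → HasIndependentColumns A k → k ≤ rank A
independentColumns⇒≤rank {k = k} A = proj₂ (proj₂ (rank-maximum A)) k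

-- The combination of the selected independent columns with coefficients `a` is X applied to `φ a`.
-- If `φ a` and `φ b` agree, then a + b, which is a - b in characteristic 2, gives a dependency and
-- vanishes; so `φ` embeds 𝔽₂^(rank A) in 𝔽₂^k.
rank-·≤ : ∀ {m k n} {A : Matrix m n} (X : Matrix m k) (Y : Matrix k n) →
          A ≐ X · Y → rank A ≤ k
rank-·≤ {A = A} X Y A≐XY with independentColumns A
... | s , ind = injection⇒≤ φ λ a b φa≗φb l → +≡0⇒≡ (ind (λ p → a p ℙ.+ b p) (dependency a b φa≗φb) l)
  where
  φ : Vector 𝔽₂ (rank A) → Vector 𝔽₂ _
  φ a l = sum λ p → a p ℙ.* Y l (s p)

  combination : ∀ a i → sum (λ p → a p ℙ.* A i (s p)) ≡ sum (λ l → X i l ℙ.* φ a l)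
  combination a i = begin
    sum (λ p → a p ℙ.* A i (s p))
      ≡⟨ sum-cong-≗ (λ p → trans (cong (a p ℙ.*_) (A≐XY i (s p)))
                                 (*-distribˡ-sum (a p) (λ l → X i l ℙ.* Y l (s p)))) ⟩
    sum (λ p → sum λ l → a p ℙ.* (X i l ℙ.* Y l (s p)))
      ≡⟨ ∑-comm (λ p l → a p ℙ.* (X i l ℙ.* Y l (s p))) ⟩
    sum (λ l → sum λ p → a p ℙ.* (X i l ℙ.* Y l (s p)))
      ≡⟨ sum-cong-≗ (λ l → trans (sum-cong-≗ λ p → swap (a p) (X i l) (Y l (s p)))
                                 (sym (*-distribˡ-sum (X i l) (λ p → a p ℙ.* Y l (s p))))) ⟩
    sum (λ l → X i l ℙ.* φ a l) ∎
    where
    open ≡-Reasoning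
    swap : ∀ x y z → x ℙ.* (y ℙ.* z) ≡ y ℙ.* (x ℙ.* z)
    swap = from-yes (∀ℙ? λ x → ∀ℙ? λ y → ∀ℙ? λ z → (x ℙ.* (y ℙ.* z)) ℙ.≟ (y ℙ.* (x ℙ.* z)))

  dependency : ∀ a b → φ a ≗ φ b → ∀ i → sum (λ p → (a p ℙ.+ b p) ℙ.* A i (s p)) ≡ 0ℙ
  dependency a b φa≗φb i = begin
    sum (λ p → (a p ℙ.+ b p) ℙ.* A i (s p))
      ≡⟨ sum-cong-≗ (λ p → ℙ.*-distribʳ-+ (A i (s p)) (a p) (b p)) ⟩
    sum (λ p → (a p ℙ.* A i (s p)) ℙ.+ (b p ℙ.* A i (s p)))
      ≡⟨ ∑-distrib-+ (λ p → a p ℙ.* A i (s p)) (λ p → b p ℙ.* A i (s p)) ⟩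
    sum (λ p → a p ℙ.* A i (s p)) ℙ.+ sum (λ p → b p ℙ.* A i (s p))
      ≡⟨ cong₂ ℙ._+_ (combination a i) (combination b i) ⟩
    sum (λ l → X i l ℙ.* φ a l) ℙ.+ sum (λ l → X i l ℙ.* φ b l)
      ≡⟨ cong (ℙ._+ _) (sum-cong-≗ λ l → cong (X i l ℙ.*_) (φa≗φb l)) ⟩
    sum (λ l → X i l ℙ.* φ b l) ℙ.+ sum (λ l → X i l ℙ.* φ b l)
      ≡⟨ ℙ.p+p≡0ℙ (sum λ l → X i l ℙ.* φ b l) ⟩
    0ℙ ∎
    where open ≡-Reasoning

-- If `y` were outside the span, every dependency would have coefficient 0 at `y` and so be trivial.
-- The span is decidable by a search through the finitely many coefficient vectors, which turns this
-- contradiction into a witness.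
dependent⇒spanned : ∀ {m k} (y : Vector 𝔽₂ m) (x : Vector (Vector 𝔽₂ m) k) →
  LinearlyIndependent x → ¬ LinearlyIndependent (y Vector.∷ x) →
  ∃ λ (c : Vector 𝔽₂ k) → ∀ i → y i ≡ sum (λ l → c l ℙ.* x l i)
dependent⇒spanned {m} {k} y x ind ¬ind = Dec.decidable-stable spanned? λ ∄c →
  ¬ind λ a dep → λ where
    zero    → coefficient≡0 ∄c a dep
    (suc l) → ind (a ∘ suc)
      (λ i → trans (sym (cong (λ p → (p ℙ.* y i) ℙ.+ sum (λ l → a (suc l) ℙ.* x l i))
                              (coefficient≡0 ∄c a dep)))
                   (dep i)) l
  where
  Spanned = ∃ λ (c : Vector 𝔽₂ k) → ∀ i → y i ≡ sum (λ l → c l ℙ.* x l i)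

  spanned? : Dec Spanned
  spanned? = searchVector refl searchParity k
    (λ c≗d y≡ i → trans (y≡ i) (sum-cong-≗ λ l → cong (ℙ._* x l i) (c≗d l)))
    (λ c → all? λ i → y i ℙ.≟ sum (λ l → c l ℙ.* x l i))

  coefficient≡0 : ¬ Spanned → (a : Vector 𝔽₂ (suc k)) →
    (∀ i → sum (λ l → a l ℙ.* (y Vector.∷ x) l i) ≡ 0ℙ) → a zero ≡ 0ℙ
  coefficient≡0 ∄c a dep = ≢1⇒≡0 λ a₀≡1 → ∄c (a ∘ suc , λ i → +≡0⇒≡
    (trans (sym (cong (λ p → (p ℙ.* y i) ℙ.+ sum (λ l → a (suc l) ℙ.* x l i)) a₀≡1)) (dep i)))

-- X consists of a largest independent selection of columns and Y of coordinates in it: a column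
-- outside the span could be added to the selection.
rank-factorisation : ∀ {m n} (A : Matrix m n) →
  ∃₂ λ (X : Matrix m (rank A)) (Y : Matrix (rank A) n) → A ≐ X · Y
rank-factorisation A with independentColumns A
... | s , ind = (λ i l → A i (s l)) , (λ l j → proj₁ (spanned j) l) , λ i j →
  trans (proj₂ (spanned j) i) (sum-cong-≗ λ l → ℙ.*-comm (proj₁ (spanned j) l) (A i (s l)))
  where
  spanned : ∀ j → ∃ λ (c : Vector 𝔽₂ (rank A)) → ∀ i → A i j ≡ sum (λ l → c l ℙ.* A i (s l))
  spanned j = dependent⇒spanned (column A j) (column A ∘ s) ind λ ind′ →
    ℕ.1+n≰n (independentColumns⇒≤rank A (j Vector.∷ s ,
      linearlyIndependent-resp {x = column A j Vector.∷ (column A ∘ s)}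
        {y = column A ∘ (j Vector.∷ s)} (λ { zero _ → refl ; (suc _) _ → refl }) ind′))

-- For a pivot `A u v ≡ 1ℙ` this is the Schur complement kept at full size: row `u` and column `v`
-- become zero.
eliminate : ∀ {m n} → Matrix m n → Fin m → Fin n → Matrix m n
eliminate A u v i j = A i j ℙ.+ (A i v ℙ.* A u j)

eliminate-sym : ∀ {n} {A : Matrix n n} → IsSymmetric A → ∀ v → IsSymmetric (eliminate A v v)
eliminate-sym {A = A} A-sym v i j = cong₂ ℙ._+_ (A-sym i j)
  (trans (cong₂ ℙ._*_ (A-sym i v) (A-sym v j)) (ℙ.*-comm (A v i) (A j v)))

-- Row u of the reduced matrix vanishes, so column v of A is independent of the
-- reduced columns.
eliminate-rank : ∀ {m n} (A : Matrix m n) u v → A u v ≡ 1ℙ →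
                 suc (rank (eliminate A u v)) ≤ rank A
eliminate-rank A u v Auv≡1 with independentColumns (eliminate A u v)
... | s , ind = independentColumns⇒≤rank A (v Vector.∷ s , independent)
  where
  independent : LinearlyIndependent (column A ∘ (v Vector.∷ s))
  independent a dep = λ where
      zero    → trans a₀≡β (sum-zero λ l → cong (ℙ._* A u (s l)) (tail≡0 l))
      (suc l) → tail≡0 l
    where
    β : 𝔽₂
    β = sum λ l → a (suc l) ℙ.* A u (s l)

    -- Row `u` of the dependency fixes the coefficient of column `v`; substituted into the other
    -- rows, it leaves a dependency of the reduced columns.
    a₀≡β : a zero ≡ β
    a₀≡β = trans (trans (sym (ℙ.*-identityʳ (a zero))) (cong (a zero ℙ.*_) (sym Auv≡1)))
                 (+≡0⇒≡ (dep u))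

    reduced-dep : ∀ i → sum (λ l → a (suc l) ℙ.* eliminate A u v i (s l)) ≡ 0ℙ
    reduced-dep i = begin
      sum (λ l → a (suc l) ℙ.* eliminate A u v i (s l))
        ≡⟨ sum-cong-≗ (λ l → expand (a (suc l)) (A i (s l)) (A i v) (A u (s l))) ⟩
      sum (λ l → (a (suc l) ℙ.* A i (s l)) ℙ.+ ((a (suc l) ℙ.* A u (s l)) ℙ.* A i v))
        ≡⟨ ∑-distrib-+ (λ l → a (suc l) ℙ.* A i (s l)) (λ l → (a (suc l) ℙ.* A u (s l)) ℙ.* A i v) ⟩
      sum (λ l → a (suc l) ℙ.* A i (s l)) ℙ.+ sum (λ l → (a (suc l) ℙ.* A u (s l)) ℙ.* A i v)
        ≡⟨ cong (sum (λ l → a (suc l) ℙ.* A i (s l)) ℙ.+_)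
                (*-distribʳ-sum (A i v) (λ l → a (suc l) ℙ.* A u (s l))) ⟨
      sum (λ l → a (suc l) ℙ.* A i (s l)) ℙ.+ (β ℙ.* A i v)
        ≡⟨ cong (λ p → sum (λ l → a (suc l) ℙ.* A i (s l)) ℙ.+ (p ℙ.* A i v)) a₀≡β ⟨
      sum (λ l → a (suc l) ℙ.* A i (s l)) ℙ.+ (a zero ℙ.* A i v)
        ≡⟨ ℙ.+-comm _ (a zero ℙ.* A i v) ⟩
      (a zero ℙ.* A i v) ℙ.+ sum (λ l → a (suc l) ℙ.* A i (s l))
        ≡⟨ dep i ⟩
      0ℙ ∎
      where
      open ≡-Reasoning
      expand : ∀ c p q r → c ℙ.* (p ℙ.+ (q ℙ.* r)) ≡ (c ℙ.* p) ℙ.+ ((c ℙ.* r) ℙ.* q)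
      expand = from-yes (∀ℙ? λ c → ∀ℙ? λ p → ∀ℙ? λ q → ∀ℙ? λ r →
        (c ℙ.* (p ℙ.+ (q ℙ.* r))) ℙ.≟ ((c ℙ.* p) ℙ.+ ((c ℙ.* r) ℙ.* q)))

    tail≡0 : ∀ l → a (suc l) ≡ 0ℙ
    tail≡0 = ind (a ∘ suc) reduced-dep

zero-rank⇒zero : ∀ {m n} (A : Matrix m n) → rank A ≤ 0 → ∀ i j → A i j ≡ 0ℙ
zero-rank⇒zero A rank≤0 i j = ≢1⇒≡0 λ Aij≡1 →
  ℕ.n≮0 (ℕ.≤-trans (eliminate-rank A i j Aij≡1) rank≤0)

-- Block matrices

-- Join independent columns of the two blocks. In the rows of `e` a dependency involves only the
-- columns from `e′`, in the rows of `f` only those from `f′`, so each half of its coefficients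
-- vanishes separately.
submatrices-rank : ∀ {m n a b c d} (A : Matrix m n)
  (e : Fin a → Fin m) (e′ : Fin b → Fin n) (f : Fin c → Fin m) (f′ : Fin d → Fin n) →
  (∀ i j → A (e i) (f′ j) ≡ 0ℙ) → (∀ i j → A (f i) (e′ j) ≡ 0ℙ) →
  rank (λ i j → A (e i) (e′ j)) ℕ.+ rank (λ i j → A (f i) (f′ j)) ≤ rank A
submatrices-rank A e e′ f f′ ef≡0 fe≡0
  with independentColumns (λ i j → A (e i) (e′ j)) | independentColumns (λ i j → A (f i) (f′ j))
... | s , s-ind | t , t-ind = independentColumns⇒≤rank A (st , independent)
  where
  k = rank (λ i j → A (e i) (e′ j))
  l = rank (λ i j → A (f i) (f′ j))

  st : Fin (k ℕ.+ l) → Fin _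
  st = (e′ ∘ s) Vector.++ (f′ ∘ t)

  independent : LinearlyIndependent (column A ∘ st)
  independent a dep = λ p → go p (splitAt k p) refl
    where
    split : ∀ i → sum (λ p → a (p ↑ˡ l) ℙ.* A i (e′ (s p))) ℙ.+
                  sum (λ p → a (k ↑ʳ p) ℙ.* A i (f′ (t p))) ≡ 0ℙ
    split i = trans (cong₂ ℙ._+_
        (sum-cong-≗ λ p → cong (λ j → a (p ↑ˡ l) ℙ.* A i j) (sym (lookup-++ˡ (e′ ∘ s) (f′ ∘ t) p)))
        (sum-cong-≗ λ p → cong (λ j → a (k ↑ʳ p) ℙ.* A i j) (sym (lookup-++ʳ (e′ ∘ s) (f′ ∘ t) p))))
      (trans (sym (sum-++ k (λ p → a p ℙ.* A i (st p)))) (dep i))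

    vanishes : ∀ {r} (c : Vector 𝔽₂ r) {x : Vector 𝔽₂ r} → (∀ p → x p ≡ 0ℙ) →
               sum (λ p → c p ℙ.* x p) ≡ 0ℙ
    vanishes c x≡0 = sum-zero λ p → trans (cong (c p ℙ.*_) (x≡0 p)) (ℙ.*-zeroʳ (c p))

    left≡0 : ∀ p → a (p ↑ˡ l) ≡ 0ℙ
    left≡0 = s-ind (λ p → a (p ↑ˡ l)) λ i →
      trans (+≡0⇒≡ (split (e i))) (vanishes _ λ p → ef≡0 i (t p))

    right≡0 : ∀ p → a (k ↑ʳ p) ≡ 0ℙ
    right≡0 = t-ind (λ p → a (k ↑ʳ p)) λ i →
      trans (sym (+≡0⇒≡ (split (f i)))) (vanishes _ λ p → fe≡0 i (s p))

    go : ∀ p z → splitAt k p ≡ z → a p ≡ 0ℙ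
    go p (inj₁ q) eq = trans (cong a (sym (splitAt⁻¹-↑ˡ eq))) (left≡0 q)
    go p (inj₂ q) eq = trans (cong a (sym (splitAt⁻¹-↑ʳ eq))) (right≡0 q)

blocks : ∀ {n a b} → (Fin n → Fin a ⊎ Fin b) → Matrix a a → Matrix b b → Matrix n n
blocks κ B C i j with κ i | κ j
... | inj₁ p | inj₁ q = B p q
... | inj₁ _ | inj₂ _ = 0ℙ
... | inj₂ _ | inj₁ _ = 0ℙ
... | inj₂ p | inj₂ q = C p q

-- Rank factorisations B = XY and C = ZW are placed side by side, padded with zeros, so that the
-- mixed products vanish and the inner dimension is the sum of the ranks.
blocks-rank : ∀ {n a b} (κ : Fin n → Fin a ⊎ Fin b) (B : Matrix a a) (C : Matrix b b) →
              rank (blocks κ B C) ≤ rank B ℕ.+ rank C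
blocks-rank κ B C = rank-·≤ left right factorises
  where
  X = proj₁ (rank-factorisation B)
  Y = proj₁ (proj₂ (rank-factorisation B))
  B≐XY = proj₂ (proj₂ (rank-factorisation B))
  Z = proj₁ (rank-factorisation C)
  W = proj₁ (proj₂ (rank-factorisation C))
  C≐ZW = proj₂ (proj₂ (rank-factorisation C))

  left : Matrix _ (rank B ℕ.+ rank C)
  left i with κ i
  ... | inj₁ p = X p Vector.++ const 0ℙ
  ... | inj₂ p = const 0ℙ Vector.++ Z p

  rightᵀ : Matrix _ (rank B ℕ.+ rank C)
  rightᵀ j with κ j
  ... | inj₁ q = column Y q Vector.++ const 0ℙ
  ... | inj₂ q = const 0ℙ Vector.++ column W q

  right : Matrix (rank B ℕ.+ rank C) _
  right l j = rightᵀ j l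

  product : ∀ {k l} (x y : Vector 𝔽₂ k) (z w : Vector 𝔽₂ l) →
    sum (λ p → (x Vector.++ z) p ℙ.* (y Vector.++ w) p) ≡
    sum (λ p → x p ℙ.* y p) ℙ.+ sum (λ p → z p ℙ.* w p)
  product {k} {l} x y z w = trans (sum-++ k _) (cong₂ ℙ._+_
    (sum-cong-≗ λ p → cong₂ ℙ._*_ (lookup-++ˡ x z p) (lookup-++ˡ y w p))
    (sum-cong-≗ λ p → cong₂ ℙ._*_ (lookup-++ʳ x z p) (lookup-++ʳ y w p)))

  factorises : blocks κ B C ≐ left · right
  factorises i j with κ i | κ j
  ... | inj₁ p | inj₁ q = sym (trans (product {rank B} {rank C} (X p) (column Y q) (const 0ℙ) (const 0ℙ))
    (trans (cong₂ ℙ._+_ (sym (B≐XY p q)) (sum-zero {rank C} λ _ → refl)) (ℙ.+-identityʳ _)))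
  ... | inj₁ p | inj₂ q = sym (trans (product {rank B} {rank C} (X p) (const 0ℙ) (const 0ℙ) (column W q))
    (cong₂ ℙ._+_ (sum-zero λ l → ℙ.*-zeroʳ (X p l)) (sum-zero {rank C} λ _ → refl)))
  ... | inj₂ p | inj₁ q = sym (trans (product {rank B} {rank C} (const 0ℙ) (column Y q) (Z p) (const 0ℙ))
    (cong₂ ℙ._+_ (sum-zero {rank B} λ _ → refl) (sum-zero λ l → ℙ.*-zeroʳ (Z p l))))
  ... | inj₂ p | inj₂ q = sym (trans (product {rank B} {rank C} (const 0ℙ) (const 0ℙ) (Z p) (column W q))
    (cong₂ ℙ._+_ (sum-zero {rank B} λ _ → refl) (sym (C≐ZW p q))))

-- Gram matrices of families of subsets

χ : ∀ {n} → Subset n → Vector 𝔽₂ n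
χ S i = if does (i ∈? S) then 1ℙ else 0ℙ

support : ∀ {n} → Vector 𝔽₂ n → Subset n
support x = Vec.tabulate λ i → does (x i ℙ.≟ 1ℙ)

χ-support : ∀ {n} (x : Vector 𝔽₂ n) i → χ (support x) i ≡ x i
χ-support x i with i ∈? support x | x i in xi
... | yes _  | 1ℙ = refl
... | no  _  | 0ℙ = refl
... | yes i∈ | 0ℙ = contradiction
  (trans (sym (trans (Vec.lookup∘tabulate _ i) (cong (λ p → does (p ℙ.≟ 1ℙ)) xi))) (Vec.[]=⇒lookup i∈)) λ ()
... | no  i∉ | 1ℙ = contradiction
  (Vec.lookup⇒[]= i _ (trans (Vec.lookup∘tabulate _ i) (cong (λ p → does (p ℙ.≟ 1ℙ)) xi))) i∉

-- By `gram-sum` this is M Mᵀ over 𝔽₂, where the columns of M are the indicator vectors of the sets.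
gram : ∀ {n} → List (Subset n) → Matrix n n
gram 𝒞 u v = parity (jointAppearances u v 𝒞)

gram-∷ : ∀ {n} (S : Subset n) 𝒞 u v → gram (S ∷ 𝒞) u v ≡ (χ S u ℙ.* χ S v) ℙ.+ gram 𝒞 u v
gram-∷ S 𝒞 u v with u ∈? S | v ∈? S
... | yes _ | yes _ = ℙ.+-homo-+ 1 (jointAppearances u v 𝒞)
... | yes _ | no  _ = refl
... | no  _ | yes _ = refl
... | no  _ | no  _ = refl

gram-support-∷ : ∀ {n} (x : Vector 𝔽₂ n) {𝒞} {A : Matrix n n} → gram 𝒞 ≐ A →
                 gram (support x ∷ 𝒞) ≐ λ u v → (x u ℙ.* x v) ℙ.+ A u v
gram-support-∷ x {𝒞} gram≐ u v = trans (gram-∷ (support x) 𝒞 u v)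
  (cong₂ ℙ._+_ (cong₂ ℙ._*_ (χ-support x u) (χ-support x v)) (gram≐ u v))

gram-sum : ∀ {n} (𝒞 : List (Subset n)) u v →
           gram 𝒞 u v ≡ sum (λ l → χ (lookup 𝒞 l) u ℙ.* χ (lookup 𝒞 l) v)
gram-sum []      u v = refl
gram-sum (S ∷ 𝒞) u v = trans (gram-∷ S 𝒞 u v) (cong ((χ S u ℙ.* χ S v) ℙ.+_) (gram-sum 𝒞 u v))

gram-sym : ∀ {n} (𝒞 : List (Subset n)) → IsSymmetric (gram 𝒞)
gram-sym 𝒞 u v = trans (gram-sum 𝒞 u v) (trans
  (sum-cong-≗ λ l → ℙ.*-comm (χ (lookup 𝒞 l) u) (χ (lookup 𝒞 l) v)) (sym (gram-sum 𝒞 v u)))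

-- Turns the parity condition of (iv) into a condition on the diagonal.
gram-diagonal : ∀ {n} v (𝒞 : List (Subset n)) → gram 𝒞 v v ≡ parity (appearances v 𝒞)
gram-diagonal v 𝒞 = cong (parity ∘ length)
  (filter-≐ (both? v v) (v ∈?_) (proj₁ , λ v∈ → v∈ , v∈) 𝒞)

gram-rank : ∀ {n} (𝒞 : List (Subset n)) → rank (gram 𝒞) ≤ length 𝒞
gram-rank 𝒞 = rank-·≤ (λ i l → χ (lookup 𝒞 l) i) (λ l j → χ (lookup 𝒞 l) j) (gram-sum 𝒞)

-- Even diagonal entries say that the indicator vectors sum to zero, so that the
-- first is the sum of the others.
gram-rank-even : ∀ {n} (𝒞 : List (Subset n)) → (∀ v → gram 𝒞 v v ≡ 0ℙ) →
                 𝒞 ≢ [] → rank (gram 𝒞) < length 𝒞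
gram-rank-even []      _    𝒞≢[] = contradiction refl 𝒞≢[]
gram-rank-even (S ∷ 𝒞) even _    = s≤s (rank-·≤
  -- With s the indicator vector of `S` and s = Σ xₗ over the other sets, s sᵀ + Σ xₗ xₗᵀ regroups
  -- as Σ xₗ (s + xₗ)ᵀ, which has one term fewer.
  (λ i l → χ (lookup 𝒞 l) i) (λ l j → χ S j ℙ.+ χ (lookup 𝒞 l) j) λ i j → begin
    gram (S ∷ 𝒞) i j
      ≡⟨ gram-∷ S 𝒞 i j ⟩
    (χ S i ℙ.* χ S j) ℙ.+ gram 𝒞 i j
      ≡⟨ cong₂ (λ p q → (p ℙ.* χ S j) ℙ.+ q) (first i) (gram-sum 𝒞 i j) ⟩
    (sum (x i) ℙ.* χ S j) ℙ.+ sum (λ l → x i l ℙ.* x j l)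
      ≡⟨ cong (ℙ._+ sum (λ l → x i l ℙ.* x j l)) (*-distribʳ-sum (χ S j) (x i)) ⟩
    sum (λ l → x i l ℙ.* χ S j) ℙ.+ sum (λ l → x i l ℙ.* x j l)
      ≡⟨ ∑-distrib-+ (λ l → x i l ℙ.* χ S j) (λ l → x i l ℙ.* x j l) ⟨
    sum (λ l → (x i l ℙ.* χ S j) ℙ.+ (x i l ℙ.* x j l))
      ≡⟨ sum-cong-≗ (λ l → sym (ℙ.*-distribˡ-+ (x i l) (χ S j) (x j l))) ⟩
    sum (λ l → x i l ℙ.* (χ S j ℙ.+ x j l)) ∎)
  where
  open ≡-Reasoning
  x : Fin _ → Vector 𝔽₂ (length 𝒞)
  x i l = χ (lookup 𝒞 l) i

  -- Squares are idempotent in 𝔽₂, so a diagonal entry is the plain sum of the indicator values.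
  first : ∀ i → χ S i ≡ sum (x i)
  first i = begin
    χ S i                             ≡⟨ ℙ.*-idem (χ S i) ⟨
    χ S i ℙ.* χ S i                   ≡⟨ +≡0⇒≡ (trans (sym (gram-∷ S 𝒞 i i)) (even i)) ⟩
    gram 𝒞 i i                        ≡⟨ gram-sum 𝒞 i i ⟩
    sum (λ l → x i l ℙ.* x i l)       ≡⟨ sum-cong-≗ (λ l → ℙ.*-idem (x i l)) ⟩
    sum (x i)                         ∎

-- A pivot on the diagonal splits off one square; for alternating A a pivot off
-- the diagonal splits off a bᵀ + b aᵀ, which is merged with c cᵀ through
--   c² + ab + ba = (a + c)² + (b + c)² + (a + b + c)².
gram-shift : ∀ {n} r (A : Matrix n n) → rank A < r → IsSymmetric A → ∀ (c : Vector 𝔽₂ n) →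
  ∃ λ 𝒞 → length 𝒞 ≤ suc (rank A) × gram 𝒞 ≐ λ i j → A i j ℙ.+ (c i ℙ.* c j)
-- The bound `r` on the rank only drives the recursion: every pivot lowers the rank.
gram-shift zero    A ()
gram-shift (suc r) A (s≤s rank≤r) A-sym c
  with any? (λ v → A v v ℙ.≟ 1ℙ) | any? (λ u → any? λ v → A u v ℙ.≟ 1ℙ)
... | yes (v , Avv≡1) | _ =
  let A′                   = eliminate A v v
      rank′<               = eliminate-rank A v v Avv≡1
      𝒞 , length≤ , gram≐ = gram-shift r A′ (ℕ.≤-trans rank′< rank≤r) (eliminate-sym A-sym v) c
  in support (column A v) ∷ 𝒞 , s≤s (ℕ.≤-trans length≤ rank′<) , λ i j →
     trans (gram-support-∷ (column A v) gram≐ i j) (trans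
       (cong (λ p → (A i v ℙ.* p) ℙ.+ (A′ i j ℙ.+ (c i ℙ.* c j))) (A-sym j v))
       (square (A i j) (A i v) (A v j) (c i ℙ.* c j)))
  where
  square : ∀ p x y q → (x ℙ.* y) ℙ.+ ((p ℙ.+ (x ℙ.* y)) ℙ.+ q) ≡ p ℙ.+ q
  square = from-yes (∀ℙ? λ p → ∀ℙ? λ x → ∀ℙ? λ y → ∀ℙ? λ q →
    ((x ℙ.* y) ℙ.+ ((p ℙ.+ (x ℙ.* y)) ℙ.+ q)) ℙ.≟ (p ℙ.+ q))
-- Without a pivot A is zero, and the single set for `c` accounts for the `suc` in the bound on the
-- length.
... | no _ | no ∄1 =
  support c ∷ [] , s≤s z≤n , λ i j → trans (gram-support-∷ c {[]} (λ _ _ → refl) i j) (trans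
    (ℙ.+-identityʳ (c i ℙ.* c j))
    (sym (cong (ℙ._+ (c i ℙ.* c j)) (≢1⇒≡0 λ Aij≡1 → ∄1 (i , j , Aij≡1)))))
... | no ∄diagonal | yes (u , v , Auv≡1) =
  -- Two of the three squares become sets, paid for by the two pivots; the third, (a + c)², is
  -- passed on as the shift of the recursive call.
  let 𝒞 , length≤ , gram≐ = gram-shift r A₂ (ℕ.≤-trans (ℕ.<-trans rank₂< rank₁<) rank≤r)
                               A₂-sym (λ i → a i ℙ.+ c i)
  in support (λ i → b i ℙ.+ c i) ∷ support (λ i → (a i ℙ.+ b i) ℙ.+ c i) ∷ 𝒞 ,
     s≤s (ℕ.≤-trans (s≤s (ℕ.≤-trans length≤ rank₂<)) rank₁<) , λ i j →
     trans (gram-support-∷ (λ i → b i ℙ.+ c i)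
             (gram-support-∷ (λ i → (a i ℙ.+ b i) ℙ.+ c i)
               (λ i j → trans (gram≐ i j)
                 (cong (ℙ._+ ((a i ℙ.+ c i) ℙ.* (a j ℙ.+ c j))) (A₂-entry i j)))) i j)
           (hyperbolic (A i j) (a i) (a j) (b i) (b j) (c i) (c j))
  where
  a b : Vector 𝔽₂ _
  a = column A u
  b = column A v
  A₁ A₂ : Matrix _ _
  A₁ = eliminate A u v
  A₂ = eliminate A₁ v u

  diagonal≡0 : ∀ w → A w w ≡ 0ℙ
  diagonal≡0 w = ≢1⇒≡0 λ Aww≡1 → ∄diagonal (w , Aww≡1)

  -- The zero diagonal keeps the mirror entry equal to 1 after the first elimination, so it can
  -- serve as the second pivot.
  A₁vu≡1 : A₁ v u ≡ 1ℙ
  A₁vu≡1 = cong₂ ℙ._+_ (trans (A-sym v u) Auv≡1) (cong (ℙ._* A u u) (diagonal≡0 v))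

  rank₁< : rank A₁ < rank A
  rank₁< = eliminate-rank A u v Auv≡1
  rank₂< : rank A₂ < rank A₁
  rank₂< = eliminate-rank A₁ v u A₁vu≡1

  A₂-entry : ∀ i j → A₂ i j ≡ A i j ℙ.+ ((a i ℙ.* b j) ℙ.+ (b i ℙ.* a j))
  A₂-entry i j = begin
    (A i j ℙ.+ (A i v ℙ.* A u j)) ℙ.+
      ((A i u ℙ.+ (A i v ℙ.* A u u)) ℙ.* (A v j ℙ.+ (A v v ℙ.* A u j)))
      ≡⟨ cong₂ (λ p q → (A i j ℙ.+ (A i v ℙ.* A u j)) ℙ.+
           ((A i u ℙ.+ (A i v ℙ.* p)) ℙ.* (A v j ℙ.+ (q ℙ.* A u j)))) (diagonal≡0 u) (diagonal≡0 v) ⟩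
    (A i j ℙ.+ (A i v ℙ.* A u j)) ℙ.+ ((A i u ℙ.+ (A i v ℙ.* 0ℙ)) ℙ.* (A v j ℙ.+ 0ℙ))
      ≡⟨ cong₂ (λ p q → (A i j ℙ.+ (A i v ℙ.* p)) ℙ.+ ((A i u ℙ.+ (A i v ℙ.* 0ℙ)) ℙ.* (q ℙ.+ 0ℙ)))
               (A-sym u j) (A-sym v j) ⟩
    (A i j ℙ.+ (b i ℙ.* a j)) ℙ.+ ((a i ℙ.+ (b i ℙ.* 0ℙ)) ℙ.* (b j ℙ.+ 0ℙ))
      ≡⟨ simplify (A i j) (a i) (a j) (b i) (b j) ⟩
    A i j ℙ.+ ((a i ℙ.* b j) ℙ.+ (b i ℙ.* a j)) ∎
    where
    open ≡-Reasoning
    simplify : ∀ p x x′ y y′ → (p ℙ.+ (y ℙ.* x′)) ℙ.+ ((x ℙ.+ (y ℙ.* 0ℙ)) ℙ.* (y′ ℙ.+ 0ℙ)) ≡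
                               p ℙ.+ ((x ℙ.* y′) ℙ.+ (y ℙ.* x′))
    simplify = from-yes (∀ℙ? λ p → ∀ℙ? λ x → ∀ℙ? λ x′ → ∀ℙ? λ y → ∀ℙ? λ y′ →
      ((p ℙ.+ (y ℙ.* x′)) ℙ.+ ((x ℙ.+ (y ℙ.* 0ℙ)) ℙ.* (y′ ℙ.+ 0ℙ))) ℙ.≟
      (p ℙ.+ ((x ℙ.* y′) ℙ.+ (y ℙ.* x′))))

  A₂-sym : IsSymmetric A₂
  A₂-sym i j = trans (A₂-entry i j) (trans
    (cong₂ ℙ._+_ (A-sym i j) (swap (a i) (b j) (b i) (a j))) (sym (A₂-entry j i)))
    where
    swap : ∀ x y′ y x′ → (x ℙ.* y′) ℙ.+ (y ℙ.* x′) ≡ (x′ ℙ.* y) ℙ.+ (y′ ℙ.* x)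
    swap = from-yes (∀ℙ? λ x → ∀ℙ? λ y′ → ∀ℙ? λ y → ∀ℙ? λ x′ →
      ((x ℙ.* y′) ℙ.+ (y ℙ.* x′)) ℙ.≟ ((x′ ℙ.* y) ℙ.+ (y′ ℙ.* x)))

  hyperbolic : ∀ p x x′ y y′ z z′ →
    ((y ℙ.+ z) ℙ.* (y′ ℙ.+ z′)) ℙ.+ ((((x ℙ.+ y) ℙ.+ z) ℙ.* ((x′ ℙ.+ y′) ℙ.+ z′)) ℙ.+
      ((p ℙ.+ ((x ℙ.* y′) ℙ.+ (y ℙ.* x′))) ℙ.+ ((x ℙ.+ z) ℙ.* (x′ ℙ.+ z′)))) ≡ p ℙ.+ (z ℙ.* z′)
  hyperbolic = from-yes (∀ℙ? λ p → ∀ℙ? λ x → ∀ℙ? λ x′ → ∀ℙ? λ y → ∀ℙ? λ y′ → ∀ℙ? λ z → ∀ℙ? λ z′ →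
    (((y ℙ.+ z) ℙ.* (y′ ℙ.+ z′)) ℙ.+ ((((x ℙ.+ y) ℙ.+ z) ℙ.* ((x′ ℙ.+ y′) ℙ.+ z′)) ℙ.+
      ((p ℙ.+ ((x ℙ.* y′) ℙ.+ (y ℙ.* x′))) ℙ.+ ((x ℙ.+ z) ℙ.* (x′ ℙ.+ z′))))) ℙ.≟ (p ℙ.+ (z ℙ.* z′)))

gram-factorisation : ∀ {n} (A : Matrix n n) → IsSymmetric A →
                     ∃ λ 𝒞 → length 𝒞 ≤ suc (rank A) × gram 𝒞 ≐ A
gram-factorisation A A-sym with gram-shift (suc (rank A)) A ℕ.≤-refl A-sym (const 0ℙ)
... | 𝒞 , length≤ , gram≐ = 𝒞 , length≤ , λ i j → trans (gram≐ i j) (ℙ.+-identityʳ (A i j))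

-- The square removed by the diagonal pivot is fed back as the shift instead of becoming a separate
-- set. The pivot lowers the rank, which absorbs the extra set allowed by `gram-shift`.
gram-factorisation-odd : ∀ {n} (A : Matrix n n) → IsSymmetric A → ∀ v → A v v ≡ 1ℙ →
                         ∃ λ 𝒞 → length 𝒞 ≤ rank A × gram 𝒞 ≐ A
gram-factorisation-odd A A-sym v Avv≡1
  with gram-shift _ (eliminate A v v) ℕ.≤-refl (eliminate-sym A-sym v) (column A v)
... | 𝒞 , length≤ , gram≐ = 𝒞 , ℕ.≤-trans length≤ (eliminate-rank A v v Avv≡1) , λ i j →
  trans (gram≐ i j) (trans (cong (λ p → eliminate A v v i j ℙ.+ (A i v ℙ.* p)) (A-sym j v))
                           (cancel (A i j) (A i v ℙ.* A v j)))
  where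
  cancel : ∀ p q → (p ℙ.+ q) ℙ.+ q ≡ p
  cancel p q = trans (ℙ.+-assoc p q q) (trans (cong (p ℙ.+_) (ℙ.p+p≡0ℙ q)) (ℙ.+-identityʳ p))

-- Systems and fitting matrices

c₂≤ : ∀ {n} (G : Graph n) 𝒞 → IsSystem G 𝒞 → c₂ G ≤ length 𝒞
c₂≤ G 𝒞 sys = proj₂ (proj₂ (c₂-minimum G)) (length 𝒞) (𝒞 , refl , sys)

mr≤ : ∀ {n} (G : Graph n) A → Fits G A → mr G ≤ rank A
mr≤ G A fit = proj₂ (proj₂ (mr-minimum G)) (rank A) (A , refl , fit)

minimumSystem : ∀ {n} (G : Graph n) → ∃ (IsMinimumSystem G)
minimumSystem G = let 𝒞 , length≡ , sys = proj₁ (proj₂ (c₂-minimum G)) in 𝒞 , sys , length≡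

minimumRankFit : ∀ {n} (G : Graph n) → ∃ (IsMinimumRankFit G)
minimumRankFit G = let A , rank≡ , fit = proj₁ (proj₂ (mr-minimum G)) in A , fit , rank≡

gram-fits : ∀ {n} (G : Graph n) 𝒞 → IsSystem G 𝒞 → Fits G (gram 𝒞)
gram-fits G 𝒞 sys = gram-sym 𝒞 , λ u v u≢v → mk⇔
  (λ ≢0 → Equivalence.from (sys u v u≢v) (≢0⇒≡1 ≢0))
  (λ u~v ≡0 → contradiction (trans (sym ≡0) (Equivalence.to (sys u v u≢v) u~v)) λ ())

fits⇒system : ∀ {n} (G : Graph n) {A} 𝒞 → Fits G A → gram 𝒞 ≐ A → IsSystem G 𝒞
fits⇒system G 𝒞 (_ , fit) gram≐ u v u≢v = mk⇔
  (λ u~v → trans (gram≐ u v) (≢0⇒≡1 (Equivalence.from (fit u v u≢v) u~v)))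
  (λ ≡1 → Equivalence.to (fit u v u≢v) λ ≡0 → contradiction
    (trans (sym ≡1) (trans (gram≐ u v) ≡0)) λ ())

fits-off-edge : ∀ {n} (G : Graph n) {A} → Fits G A → ∀ {u v} → u ≢ v →
                ¬ Graph._~_ G u v → A u v ≡ 0ℙ
fits-off-edge G {A} (_ , fit) {u} {v} u≢v u≁v =
  Dec.decidable-stable (A u v ℙ.≟ 0ℙ) λ ≢0 → u≁v (Equivalence.to (fit u v u≢v) ≢0)

-- A nonzero entry over 𝔽₂ is 1, so adjacency determines everything off the diagonal.
fits-unique : ∀ {n} (G : Graph n) {A B} → Fits G A → Fits G B →
              (∀ v → A v v ≡ B v v) → A ≐ B
fits-unique G fitA fitB diagonal≡ u v with u ≟ᶠ v | Graph._~?_ G u v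
... | yes refl | _       = diagonal≡ u
... | no  u≢v  | yes u~v = trans (≢0⇒≡1 (Equivalence.from (proj₂ fitA u v u≢v) u~v))
                             (sym (≢0⇒≡1 (Equivalence.from (proj₂ fitB u v u≢v) u~v)))
... | no  u≢v  | no  u≁v = trans (fits-off-edge G fitA u≢v u≁v) (sym (fits-off-edge G fitB u≢v u≁v))

mr≤c₂ : ∀ {n} (G : Graph n) → mr G ≤ c₂ G
mr≤c₂ G = let 𝒞 , sys , length≡ = minimumSystem G in
  ℕ.≤-trans (mr≤ G (gram 𝒞) (gram-fits G 𝒞 sys)) (ℕ.≤-trans (gram-rank 𝒞) (ℕ.≤-reflexive length≡))

c₂≤1+mr : ∀ {n} (G : Graph n) → c₂ G ≤ suc (mr G)
c₂≤1+mr G =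
  let A , fit , rank≡      = minimumRankFit G
      𝒞 , length≤ , gram≐ = gram-factorisation A (proj₁ fit)
  in ℕ.≤-trans (c₂≤ G 𝒞 (fits⇒system G 𝒞 fit gram≐)) (ℕ.≤-trans length≤ (ℕ.≤-reflexive (cong suc rank≡)))

c₂≢mr⇒c₂≡1+mr : ∀ {n} (G : Graph n) → c₂ G ≢ mr G → c₂ G ≡ suc (mr G)
c₂≢mr⇒c₂≡1+mr G c₂≢mr =
  ℕ.≤-antisym (c₂≤1+mr G) (ℕ.≤∧≢⇒< (mr≤c₂ G) (c₂≢mr ∘ sym))

c₂≡1+mr⇒c₂≢mr : ∀ {n} (G : Graph n) → c₂ G ≡ suc (mr G) → c₂ G ≢ mr G
c₂≡1+mr⇒c₂≢mr G c₂≡1+mr c₂≡mr = ℕ.1+n≢n (trans (sym c₂≡1+mr) c₂≡mr)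

even-minimum-system⇒c₂≢mr : ∀ {n} (G : Graph n) → NonemptyGraph G →
  ∀ 𝒞 → IsMinimumSystem G 𝒞 → (∀ v → gram 𝒞 v v ≡ 0ℙ) → c₂ G ≢ mr G
even-minimum-system⇒c₂≢mr G (u , v , u~v) 𝒞 (sys , length≡) even c₂≡mr = ℕ.<-irrefl refl (begin-strict
  mr G          ≤⟨ mr≤ G (gram 𝒞) (gram-fits G 𝒞 sys) ⟩
  rank (gram 𝒞) <⟨ gram-rank-even 𝒞 even 𝒞≢[] ⟩
  length 𝒞      ≡⟨ length≡ ⟩
  c₂ G          ≡⟨ c₂≡mr ⟩
  mr G          ∎)
  where
  open ℕ.≤-Reasoning
  -- An edge cannot come from the empty family; this is where nonemptiness of the graph enters.
  𝒞≢[] : 𝒞 ≢ []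
  𝒞≢[] refl = contradiction (Equivalence.to (sys u v λ u≡v → Graph.~-irrefl G u≡v u~v) u~v) λ ()

-- Conditions (i), (iii) and (v) are compared through this property. Unlike (i) it holds for
-- edgeless graphs as well, so it can be tested on every component, isolated vertices included.
AllAlternating : ∀ {n} → Graph n → Set
AllAlternating G = ∀ A → IsMinimumRankFit G A → ∀ v → A v v ≡ 0ℙ

-- A diagonal 1 in a fit of minimum rank would yield a system of only `mr G` sets.
c₂≢mr⇒alternating : ∀ {n} (G : Graph n) → c₂ G ≢ mr G → AllAlternating G
c₂≢mr⇒alternating G c₂≢mr A (fit , rank≡) v = ≢1⇒≡0 λ Avv≡1 →
  let 𝒞 , length≤ , gram≐ = gram-factorisation-odd A (proj₁ fit) v Avv≡1
  in c₂≢mr (ℕ.≤-antisym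
       (ℕ.≤-trans (c₂≤ G 𝒞 (fits⇒system G 𝒞 fit gram≐)) (ℕ.≤-trans length≤ (ℕ.≤-reflexive rank≡)))
       (mr≤c₂ G))

-- If the two numbers agreed, the Gram matrix of a minimum system would have minimum rank, hence
-- zero diagonal; but evenness pushes its rank strictly below the number of sets.
alternating⇒c₂≢mr : ∀ {n} (G : Graph n) → NonemptyGraph G → AllAlternating G → c₂ G ≢ mr G
alternating⇒c₂≢mr G nonempty alt c₂≡mr =
  let 𝒞 , sys , length≡ = minimumSystem G
      fit               = gram-fits G 𝒞 sys
      rank≡             = ℕ.≤-antisym
        (ℕ.≤-trans (gram-rank 𝒞) (ℕ.≤-reflexive (trans length≡ c₂≡mr))) (mr≤ G (gram 𝒞) fit)
  in even-minimum-system⇒c₂≢mr G nonempty 𝒞 (sys , length≡) (alt (gram 𝒞) (fit , rank≡)) c₂≡mr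

UniqueAlternatingFit : ∀ {n} → Graph n → Set
UniqueAlternatingFit {n} G = ∃ λ (A : Matrix n n) →
  IsMinimumRankFit G A × (∀ B → IsMinimumRankFit G B → B ≐ A) × (∀ v → A v v ≡ 0ℙ)

alternating⇒unique : ∀ {n} (G : Graph n) → AllAlternating G → UniqueAlternatingFit G
alternating⇒unique G alt =
  let A , minA = minimumRankFit G
  in A , minA ,
     (λ B minB → fits-unique G (proj₁ minB) (proj₁ minA) λ v → trans (alt B minB v) (sym (alt A minA v))) ,
     alt A minA

unique⇒alternating : ∀ {n} (G : Graph n) → UniqueAlternatingFit G → AllAlternating G
unique⇒alternating G (A , _ , unique , A-alt) B minB v = trans (unique B minB v v) (A-alt v)

EvenMinimumSystem : ∀ {n} → Graph n → Set
EvenMinimumSystem {n} G = ∃ λ (𝒞 : List (Subset n)) →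
  IsMinimumSystem G 𝒞 × (∀ v → parity (appearances v 𝒞) ≡ 0ℙ)

-- Factorising a fit of minimum rank gives at most `suc (mr G)` sets, which here is `c₂ G`, so the
-- system is minimum; its appearance parities are the zero diagonal of the fit.
c₂≢mr⇒even : ∀ {n} (G : Graph n) → c₂ G ≢ mr G → EvenMinimumSystem G
c₂≢mr⇒even G c₂≢mr =
  let A , fit , rank≡      = minimumRankFit G
      𝒞 , length≤ , gram≐ = gram-factorisation A (proj₁ fit)
      sys                  = fits⇒system G 𝒞 fit gram≐
      length≡              = ℕ.≤-antisym
        (ℕ.≤-trans length≤ (ℕ.≤-reflexive (trans (cong suc rank≡) (sym (c₂≢mr⇒c₂≡1+mr G c₂≢mr)))))
        (c₂≤ G 𝒞 sys)
  in 𝒞 , (sys , length≡) , λ v → trans (sym (gram-diagonal v 𝒞))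
       (trans (gram≐ v v) (c₂≢mr⇒alternating G c₂≢mr A (fit , rank≡) v))

even⇒c₂≢mr : ∀ {n} (G : Graph n) → NonemptyGraph G → EvenMinimumSystem G → c₂ G ≢ mr G
even⇒c₂≢mr G nonempty (𝒞 , minimal , even) =
  even-minimum-system⇒c₂≢mr G nonempty 𝒞 minimal λ v → trans (gram-diagonal v 𝒞) (even v)

-- Components

-- Used twice: to label the vertices of a component, and to label those outside it.
enumerate : ∀ {n} {P : Fin n → Set} → U.Decidable P →
  ∃ λ k → ∃ λ (e : Fin k → Fin n) → Injective _≡_ _≡_ e × (∀ v → (∃ λ w → e w ≡ v) ⇔ P v)
enumerate {zero}  P? = zero , (λ ()) , (λ { {()} }) , λ ()
enumerate {suc n} {P} P? with enumerate (P? ∘ suc) | P? zero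
... | k , e , e-injective , image | yes p₀ = suc k , e′ , e′-injective , λ where
    zero    → mk⇔ (λ _ → p₀) (λ _ → zero , refl)
    (suc v) → mk⇔ (λ { (suc w , refl) → Equivalence.to (image v) (w , refl) })
                  (λ p → let w , ew≡v = Equivalence.from (image v) p in suc w , cong suc ew≡v)
  where
  e′ : Fin (suc k) → Fin (suc n)
  e′ zero    = zero
  e′ (suc w) = suc (e w)
  e′-injective : Injective _≡_ _≡_ e′
  e′-injective {zero}  {zero}  _  = refl
  e′-injective {suc _} {suc _} eq = cong suc (e-injective (suc-injective eq))
... | k , e , e-injective , image | no ¬p₀ =
  k , suc ∘ e , e-injective ∘ suc-injective , λ where
    zero    → mk⇔ (λ ()) (λ p₀ → contradiction p₀ ¬p₀)
    (suc v) → mk⇔ (λ { (w , refl) → Equivalence.to (image v) (w , refl) })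
                  (λ p → let w , ew≡v = Equivalence.from (image v) p in w , cong suc ew≡v)

component : ∀ {n} (G : Graph n) root → U.Decidable (Star (Graph._~_ G) root) →
            ∃ λ (C : Component G) → Component.root C ≡ root
component G root reachable? with enumerate reachable?
... | k , e , e-injective , image = record
  { graph           = record
    { _~_      = λ u v → e u ~ e v
    ; _~?_     = λ u v → e u ~? e v
    ; ~-sym    = ~-sym
    ; ~-irrefl = ~-irrefl ∘ cong e
    }
  ; embed           = e
  ; embed-injective = e-injective
  ; embed-induced   = λ _ _ → mk⇔ id id
  ; root            = root
  ; image           = image
  } , refl
  where open Graph G

module _ {n} {G : Graph n} (C : Component G) where
  open Graph G
  open Component C

  private
    -- Membership in a given component is decided by searching its labels, without deciding
    -- reachability.
    outside? : U.Decidable (λ v → ¬ ∃ λ w → embed w ≡ v)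
    outside? v = Dec.¬? (any? λ w → embed w ≟ᶠ v)

    enumeration = enumerate outside?
    others      = proj₁ enumeration

    rest : Fin others → Fin n
    rest = proj₁ (proj₂ enumeration)

    rest-image : ∀ v → (∃ λ w → rest w ≡ v) ⇔ (¬ ∃ λ w → embed w ≡ v)
    rest-image = proj₂ (proj₂ (proj₂ enumeration))

    locate : ∀ v → (∃ λ w → embed w ≡ v) ⊎ (∃ λ w → rest w ≡ v)
    locate v with any? (λ w → embed w ≟ᶠ v)
    ... | yes inside = inj₁ inside
    ... | no outside = inj₂ (Equivalence.from (rest-image v) outside)

    κ : Fin n → Fin order ⊎ Fin others
    κ v with locate v
    ... | inj₁ (w , _) = inj₁ w
    ... | inj₂ (w , _) = inj₂ w

    κ-sound : ∀ v → [ embed , rest ]′ (κ v) ≡ v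
    κ-sound v with locate v
    ... | inj₁ (w , ew≡v) = ew≡v
    ... | inj₂ (w , rw≡v) = rw≡v

    embed≢rest : ∀ u v → embed u ≢ rest v
    embed≢rest u v eu≡rv = Equivalence.to (rest-image (rest v)) (v , refl) (u , eu≡rv)

    κ-embed : ∀ w → κ (embed w) ≡ inj₁ w
    κ-embed w with κ (embed w) | κ-sound (embed w)
    ... | inj₁ w′ | eq = cong inj₁ (embed-injective eq)
    ... | inj₂ w′ | eq = contradiction (sym eq) (embed≢rest w w′)

    -- Such an edge would prolong a path from the root to a vertex outside the component.
    embed≁rest : ∀ u v → ¬ (embed u ~ rest v)
    embed≁rest u v u~v = Equivalence.to (rest-image (rest v)) (v , refl)
      (Equivalence.from (image (rest v))
        (Equivalence.to (image (embed u)) (u , refl) ◅◅ (u~v ◅ ε)))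

  restriction : Matrix n n → Matrix order order
  restriction A u v = A (embed u) (embed v)

  private
    complementary : Matrix n n → Matrix others others
    complementary A u v = A (rest u) (rest v)

  replacement : Matrix n n → Matrix order order → Matrix n n
  replacement A B = blocks κ B (complementary A)

  replacement-diagonal : ∀ A B w → replacement A B (embed w) (embed w) ≡ B w w
  replacement-diagonal A B w with κ (embed w) | κ-embed w
  ... | _ | refl = refl

  restriction-fits : ∀ {A} → Fits G A → Fits graph (restriction A)
  restriction-fits (A-sym , fit) = (λ u v → A-sym (embed u) (embed v)) , λ u v u≢v →
    mk⇔ (λ ≢0 → Equivalence.from (embed-induced u v)
                  (Equivalence.to (fit _ _ (u≢v ∘ embed-injective)) ≢0))
        (λ u~v → Equivalence.from (fit _ _ (u≢v ∘ embed-injective))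
                  (Equivalence.to (embed-induced u v) u~v))

  replacement-fits : ∀ {A B} → Fits G A → Fits graph B → Fits G (replacement A B)
  replacement-fits {A} {B} (A-sym , A-fit) (B-sym , B-fit) = symmetric , fit
    where
    symmetric : IsSymmetric (replacement A B)
    symmetric u v with κ u | κ v
    ... | inj₁ p | inj₁ q = B-sym p q
    ... | inj₁ _ | inj₂ _ = refl
    ... | inj₂ _ | inj₁ _ = refl
    ... | inj₂ p | inj₂ q = A-sym (rest p) (rest q)

    fit : ∀ u v → u ≢ v → replacement A B u v ≢ 0ℙ ⇔ u ~ v
    fit u v u≢v with κ u | κ v | κ-sound u | κ-sound v
    ... | inj₁ p | inj₁ q | refl | refl = mk⇔
      (λ ≢0 → Equivalence.to (embed-induced p q) (Equivalence.to (B-fit p q (u≢v ∘ cong embed)) ≢0))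
      (λ u~v → Equivalence.from (B-fit p q (u≢v ∘ cong embed)) (Equivalence.from (embed-induced p q) u~v))
    ... | inj₁ p | inj₂ q | refl | refl = mk⇔ (contradiction refl)
      (λ u~v → contradiction u~v (embed≁rest p q))
    ... | inj₂ p | inj₁ q | refl | refl = mk⇔ (contradiction refl)
      (λ u~v → contradiction (~-sym u~v) (embed≁rest q p))
    ... | inj₂ p | inj₂ q | refl | refl = A-fit (rest p) (rest q) u≢v

  -- No edge leaves the component, so `rank A` is at least the sum of the ranks of its two blocks,
  -- while the new matrix has rank at most `rank B` plus that of the untouched block. The additive
  -- form avoids subtraction.
  replacement-rank : ∀ {A} → Fits G A → ∀ B →
                     rank (restriction A) ℕ.+ rank (replacement A B) ≤ rank A ℕ.+ rank B
  replacement-rank {A} fit B = begin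
    rank (restriction A) ℕ.+ rank (replacement A B)
      ≤⟨ ℕ.+-monoʳ-≤ (rank (restriction A)) (blocks-rank κ B (complementary A)) ⟩
    rank (restriction A) ℕ.+ (rank B ℕ.+ rank (complementary A))
      ≡⟨ cong (rank (restriction A) ℕ.+_) (ℕ.+-comm (rank B) (rank (complementary A))) ⟩
    rank (restriction A) ℕ.+ (rank (complementary A) ℕ.+ rank B)
      ≡⟨ ℕ.+-assoc (rank (restriction A)) (rank (complementary A)) (rank B) ⟨
    rank (restriction A) ℕ.+ rank (complementary A) ℕ.+ rank B
      ≤⟨ ℕ.+-monoˡ-≤ (rank B) (submatrices-rank A embed embed rest rest
           (λ i j → fits-off-edge G fit (embed≢rest i j) (embed≁rest i j))
           (λ i j → fits-off-edge G fit (embed≢rest j i ∘ sym) (embed≁rest j i ∘ ~-sym))) ⟩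
    rank A ℕ.+ rank B ∎
    where open ℕ.≤-Reasoning

  -- Exchanging the block for a fit of minimum rank of the component cannot bring the rank below
  -- `mr G`, so the block was already minimal.
  restriction-minimum : ∀ {A} → IsMinimumRankFit G A → IsMinimumRankFit graph (restriction A)
  restriction-minimum {A} (fit , rank≡) = restriction-fits fit , ℕ.≤-antisym
    (ℕ.+-cancelʳ-≤ (rank A) (rank (restriction A)) (mr graph) (begin
      rank (restriction A) ℕ.+ rank A
        ≡⟨ cong (rank (restriction A) ℕ.+_) rank≡ ⟩
      rank (restriction A) ℕ.+ mr G
        ≤⟨ ℕ.+-monoʳ-≤ (rank (restriction A)) (mr≤ G (replacement A B) (replacement-fits fit B-fit)) ⟩
      rank (restriction A) ℕ.+ rank (replacement A B)
        ≤⟨ replacement-rank fit B ⟩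
      rank A ℕ.+ rank B
        ≡⟨ trans (ℕ.+-comm (rank A) (rank B)) (cong (ℕ._+ rank A) B-rank≡) ⟩
      mr graph ℕ.+ rank A ∎))
    (mr≤ graph (restriction A) (restriction-fits fit))
    where
    open ℕ.≤-Reasoning
    B       = proj₁ (minimumRankFit graph)
    B-fit   = proj₁ (proj₂ (minimumRankFit graph))
    B-rank≡ = proj₂ (proj₂ (minimumRankFit graph))

  -- Conversely, the new block has rank at most that of the old one, so the exchange does not raise
  -- the total rank.
  replacement-minimum : ∀ {A B} → IsMinimumRankFit G A → IsMinimumRankFit graph B →
                        IsMinimumRankFit G (replacement A B)
  replacement-minimum {A} {B} (A-fit , A-rank≡) (B-fit , B-rank≡) =
    replacement-fits A-fit B-fit , ℕ.≤-antisym
      (ℕ.+-cancelˡ-≤ (rank (restriction A)) _ _ (begin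
        rank (restriction A) ℕ.+ rank (replacement A B)
          ≤⟨ replacement-rank A-fit B ⟩
        rank A ℕ.+ rank B
          ≡⟨ trans (ℕ.+-comm (rank A) (rank B)) (cong₂ ℕ._+_ B-rank≡ A-rank≡) ⟩
        mr graph ℕ.+ mr G
          ≤⟨ ℕ.+-monoˡ-≤ (mr G) (mr≤ graph (restriction A) (restriction-fits A-fit)) ⟩
        rank (restriction A) ℕ.+ mr G ∎))
      (mr≤ G (replacement A B) (replacement-fits A-fit B-fit))
    where open ℕ.≤-Reasoning

  -- Every fit of minimum rank of the component occurs as a block in one of `G`, where its diagonal
  -- is known to vanish.
  component-alternating : AllAlternating G → AllAlternating graph
  component-alternating alt B minB w =
    let A , minA = minimumRankFit G in
    trans (sym (replacement-diagonal A B w))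
          (alt (replacement A B) (replacement-minimum minA minB) (embed w))

-- The zero matrix fits and factors through dimension 0, so a fit of minimum rank has rank 0 and is
-- zero.
edgeless-alternating : ∀ {n} (G : Graph n) → ¬ NonemptyGraph G → AllAlternating G
edgeless-alternating G edgeless A (_ , rank≡) v = zero-rank⇒zero A (begin
  rank A           ≡⟨ rank≡ ⟩
  mr G             ≤⟨ mr≤ G zeroMatrix zero-fits ⟩
  rank zeroMatrix  ≤⟨ rank-·≤ {k = 0} {A = zeroMatrix} (λ _ ()) (λ ()) (λ _ _ → refl) ⟩
  0                ∎) v v
  where
  open ℕ.≤-Reasoning
  zeroMatrix : Matrix _ _
  zeroMatrix _ _ = 0ℙ
  zero-fits : Fits G zeroMatrix
  zero-fits = (λ _ _ → refl) , λ u v _ →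
    mk⇔ (contradiction refl) (λ u~v → contradiction (u , v , u~v) edgeless)

-- Bridges the restriction of (v) to components with an edge.
alternating-if-nonempty : ∀ {n} (G : Graph n) →
  (NonemptyGraph G → AllAlternating G) → AllAlternating G
alternating-if-nonempty G nonempty-alt = decide (any? λ u → any? (Graph._~?_ G u))
  where
  decide : Dec (NonemptyGraph G) → AllAlternating G
  decide (yes nonempty) = nonempty-alt nonempty
  decide (no  edgeless) = edgeless-alternating G edgeless

-- Deciding reachability is avoided: the goal is stable under double negation.
components-alternating : ∀ {n} (G : Graph n) →
  (∀ (C : Component G) → NonemptyGraph (Component.graph C) → AllAlternating (Component.graph C)) →
  AllAlternating G
components-alternating G components-alt A minA v =
  Dec.decidable-stable (A v v ℙ.≟ 0ℙ) λ Avv≢0 →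
    -- As there are finitely many vertices, the double negations of the single decisions combine
    -- into that of a decision procedure for all of them.
    sequence (RawMonad.rawApplicative ¬¬-Monad) (λ w → ¬¬-excluded-middle)
      λ reachable? → Avv≢0 (diagonal≡0 reachable?)
  where
  -- The diagonal entry at `v` is read off inside the component rooted at `v`, which contains `v` by
  -- the empty path.
  diagonal≡0 : U.Decidable (Star (Graph._~_ G) v) → A v v ≡ 0ℙ
  diagonal≡0 reachable? =
    let C , root≡v = component G v reachable?
        w , ew≡v   = Equivalence.from (Component.image C v)
                       (subst (λ r → Star (Graph._~_ G) r v) (sym root≡v) ε)
    in subst (λ u → A u u ≡ 0ℙ) ew≡v
         (alternating-if-nonempty (Component.graph C) (components-alt C)
           (restriction C A) (restriction-minimum C minA) w)

theorem4p12 : ∀ {n : ℕ} (G : Graph n) → NonemptyGraph G →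
  let i   = c₂ G ≢ mr G
      ii  = c₂ G ≡ suc (mr G)
      iii = ∃ λ (A : Matrix n n) →
              IsMinimumRankFit G A ×
              (∀ B → IsMinimumRankFit G B → B ≐ A) ×
              (∀ v → A v v ≡ 0ℙ)
      iv  = ∃ λ (𝒞 : List (Subset n)) →
              IsMinimumSystem G 𝒞 ×
              (∀ v → parity (appearances v 𝒞) ≡ 0ℙ)
      v   = ∀ (C : Component G) → NonemptyGraph (Component.graph C) →
              c₂ (Component.graph C) ≡ suc (mr (Component.graph C))
  in (i ⇔ ii) × (i ⇔ iii) × (i ⇔ iv) × (i ⇔ v)
theorem4p12 G nonempty =
  mk⇔ (c₂≢mr⇒c₂≡1+mr G) (c₂≡1+mr⇒c₂≢mr G) ,
  mk⇔ (alternating⇒unique G ∘ c₂≢mr⇒alternating G)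
      (alternating⇒c₂≢mr G nonempty ∘ unique⇒alternating G) ,
  mk⇔ (c₂≢mr⇒even G) (even⇒c₂≢mr G nonempty) ,
  mk⇔ (λ c₂≢mr C C-nonempty → let H = Component.graph C in
         c₂≢mr⇒c₂≡1+mr H (alternating⇒c₂≢mr H C-nonempty
           (component-alternating C (c₂≢mr⇒alternating G c₂≢mr))))
      (λ all-components → alternating⇒c₂≢mr G nonempty
         (components-alternating G λ C C-nonempty → let H = Component.graph C in
           c₂≢mr⇒alternating H (c₂≡1+mr⇒c₂≢mr H (all-components C C-nonempty))))
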